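{- Let $\widehat{G}$ be a signed bigraph whose underlying graph is non-separable. Then $\widehat{G}$ is a chordal signed bigraph if and only if it does not contain any signed graph in $F_1\cup F_2\cup\cdots\cup F_6$ as an induced subgraph.
   Context: A signed graph is a finite simple graph with each edge assigned a sign, positive or negative; induced subgraphs inherit signs; containment as an induced subgraph is up to sign-preserving isomorphism. A signed bigraph has bipartite underlying graph with fixed bipartition $(X,Y)$. A bigraph is separable if it contains an induced $2K_2$, non-separable otherwise. A subgraph $H$ is a biclique if every vertex of $V(H)\cap X$ is adjacent to every vertex of $V(H)\cap Y$; positive if all its edges are positive. For an edge $uv$, $N(uv)=(N(u)\cup N(v))\setminus\{u,v\}$; $uv$ is signed simplicial if the subgraph induced by $N(uv)$ is a positive biclique. A signed bigraph is a chordal signed bigraph if its edges can be ordered $e_1,\dots,e_m$ so that each $e_i$ is signed simplicial in the signed bigraph obtained by deleting edges $e_1,\dots,e_{i-1}$ (keeping all vertices). In what follows, "arbitrary" signs mean all sign choices are included in the set. $F_1$: $K_{2,2}$ with all edges negative. $F_2$: $K_{2,3}$ with parts $\{a,b\},\{p,q,r\}$; $pa,aq,qb,br$ negative; $bp,ar$ arbitrary. $F_3$: $K_{2,4}$ with parts $\{a,b\},\{p,q,r,s\}$; $ap,aq,br,bs$ negative; $bp,bq,ar,as$ arbitrary. $F_4$: $K_{3,3}$ with parts $\{a,b,c\},\{p,q,r\}$; $ap,bq,cr$ negative; other six edges arbitrary. $F_5$: parts $\{a,b,c\},\{p,q,r\}$, all nine cross pairs are edges except $ar$; $bp,cq$ negative;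 $ap,aq,bq,br,cp,cr$ arbitrary. $F_6$: parts $\{a,b,c,d\},\{p,q,r,s\}$, edges exactly $pa,pb,pc,pd,qa,qb,qc,qd,rc,rd,sc,sd$; $ap,bp,cq,dr,ds$ negative; $aq,bq,cp,dp,dq,cr,cs$ arbitrary. -}

module Defs where

open import Data.Nat using (ℕ)
open import Data.Fin using (Fin; zero; suc; _≟_)
open import Data.Fin.Patterns
open import Data.Bool using (Bool; true; false; if_then_else_)
open import Data.Maybe using (Maybe; just; nothing)
open import Data.Product using (Σ; _×_; _,_)
open import Data.List using (List; []; _∷_)
open import Relation.Nullary using (¬_; does)
open import Relation.Binary.PropositionalEquality using (_≡_; _≢_)
open import Function.Definitions using (Injective)
open import Data.Unit using (⊤)

data Sign : Set where
  pos neg : Sign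

Adj : ℕ → Set
Adj n = Fin n → Fin n → Maybe Sign

-- A signed bigraph with fixed bipartition (X = side false, Y = side true).
-- Simple: symmetric, and every edge joins X and Y (hence no loops).
record SignedBigraph : Set where
  field
    n    : ℕ
    side : Fin n → Bool
    adj  : Adj n
    sym  : ∀ u v → adj u v ≡ adj v u
    bip  : ∀ u v → adj u v ≢ nothing → side u ≢ side v
open SignedBigraph public

Edge : ∀ {n} → Adj n → Fin n → Fin n → Set
Edge a u v = a u v ≢ nothing

NonSeparable : SignedBigraph → Set
NonSeparable G = ∀ (a b c d : Fin (n G)) →
  a ≢ b → a ≢ c → a ≢ d → b ≢ c → b ≢ d → c ≢ d →
  Edge (adj G) a b → Edge (adj G) c d →
  ¬ (adj G a c ≡ nothing × adj G a d ≡ nothing × adj G b c ≡ nothing × adj G b d ≡ nothing)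

InNbhd : ∀ {n} → Adj n → Fin n → Fin n → Fin n → Set
InNbhd a u v x = (Edge a u x ⊎' Edge a v x) × x ≢ u × x ≢ v
  where
  open import Data.Sum renaming (_⊎_ to _⊎'_)

SignedSimplicial : ∀ {n} → (Fin n → Bool) → Adj n → Fin n → Fin n → Set
SignedSimplicial side a u v = ∀ x y → InNbhd a u v x → InNbhd a u v y →
  side x ≡ false → side y ≡ true → a x y ≡ just pos

deleteEdge : ∀ {n} → Adj n → Fin n → Fin n → Adj n
deleteEdge a u v x y =
  if (does (x ≟ u) ∧ does (y ≟ v)) ∨ (does (x ≟ v) ∧ does (y ≟ u)) then nothing else a x y
  where open import Data.Bool using (_∧_; _∨_)

-- A list of (ordered representatives of) edges e₁,…,eₘ is a signed-simplicial
-- elimination ordering of the current graph: each eᵢ is an edge of, and signed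
-- simplicial in, the graph with e₁,…,eᵢ₋₁ deleted, and after deleting all of
-- them no edge remains (so the list enumerates every edge exactly once).
NoEdges : ∀ {n} → Adj n → Set
NoEdges a = ∀ x y → a x y ≡ nothing

IsOrdering : ∀ {n} → (Fin n → Bool) → Adj n → List (Fin n × Fin n) → Set
IsOrdering side a [] = NoEdges a
IsOrdering side a ((u , v) ∷ es) =
  Edge a u v × SignedSimplicial side a u v × IsOrdering side (deleteEdge a u v) es

ChordalSignedBigraph : SignedBigraph → Set
ChordalSignedBigraph G = Σ (List (Fin (n G) × Fin (n G))) λ es → IsOrdering (side G) (adj G) es

ContainsInduced : ∀ {k} → SignedBigraph → Adj k → Set
ContainsInduced {k} G H = Σ (Fin k → Fin (n G)) λ f →
  Injective _≡_ _≡_ f × (∀ i j → adj G (f i) (f j) ≡ H i j)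

data Label : Set where
  none negE anyE : Label

Conforms : Label → Maybe Sign → Set
Conforms none     s        = s ≡ nothing
Conforms negE     s        = s ≡ just neg
Conforms anyE     nothing  = Data.Empty.⊥ where import Data.Empty
Conforms anyE     (just _) = ⊤

patternOf : ∀ {k} → List (Fin k × Fin k × Label) → Fin k → Fin k → Label
patternOf [] x y = none
patternOf ((u , v , l) ∷ es) x y =
  if (does (x ≟ u) ∧ does (y ≟ v)) ∨ (does (x ≟ v) ∧ does (y ≟ u)) then l else patternOf es x y
  where open import Data.Bool using (_∧_; _∨_)

record Family : Set where
  constructor family
  field
    size  : ℕ
    edges : List (Fin size × Fin size × Label)

Member : (F : Family) → Adj (Family.size F) → Set
Member F H = ∀ i j → Conforms (patternOf (Family.edges F) i j) (H i j)

ContainsMemberOf : SignedBigraph → Family → Set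
ContainsMemberOf G F = Σ (Adj (Family.size F)) λ H → Member F H × ContainsInduced G H

-- F₁: K₂,₂, all negative. a=0,b=1 | p=2,q=3
F₁ : Family
F₁ = family 4 ((0F , 2F , negE) ∷ (0F , 3F , negE) ∷ (1F , 2F , negE) ∷ (1F , 3F , negE) ∷ [])

-- F₂: a=0,b=1 | p=2,q=3,r=4
F₂ : Family
F₂ = family 5 ((2F , 0F , negE) ∷ (0F , 3F , negE) ∷ (3F , 1F , negE) ∷ (1F , 4F , negE)
             ∷ (1F , 2F , anyE) ∷ (0F , 4F , anyE) ∷ [])

-- F₃: a=0,b=1 | p=2,q=3,r=4,s=5
F₃ : Family
F₃ = family 6 ((0F , 2F , negE) ∷ (0F , 3F , negE) ∷ (1F , 4F , negE) ∷ (1F , 5F , negE)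
             ∷ (1F , 2F , anyE) ∷ (1F , 3F , anyE) ∷ (0F , 4F , anyE) ∷ (0F , 5F , anyE) ∷ [])

-- F₄: a=0,b=1,c=2 | p=3,q=4,r=5
F₄ : Family
F₄ = family 6 ((0F , 3F , negE) ∷ (1F , 4F , negE) ∷ (2F , 5F , negE)
             ∷ (0F , 4F , anyE) ∷ (0F , 5F , anyE) ∷ (1F , 3F , anyE)
             ∷ (1F , 5F , anyE) ∷ (2F , 3F , anyE) ∷ (2F , 4F , anyE) ∷ [])

-- F₅: a=0,b=1,c=2 | p=3,q=4,r=5 ; all cross pairs except ar
F₅ : Family
F₅ = family 6 ((1F , 3F , negE) ∷ (2F , 4F , negE)
             ∷ (0F , 3F , anyE) ∷ (0F , 4F , anyE) ∷ (1F , 4F , anyE)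
             ∷ (1F , 5F , anyE) ∷ (2F , 3F , anyE) ∷ (2F , 5F , anyE) ∷ [])

-- F₆: a=0,b=1,c=2,d=3 | p=4,q=5,r=6,s=7
F₆ : Family
F₆ = family 8 ((0F , 4F , negE) ∷ (1F , 4F , negE) ∷ (2F , 5F , negE) ∷ (3F , 6F , negE) ∷ (3F , 7F , negE)
             ∷ (0F , 5F , anyE) ∷ (1F , 5F , anyE) ∷ (2F , 4F , anyE) ∷ (3F , 4F , anyE)
             ∷ (3F , 5F , anyE) ∷ (2F , 6F , anyE) ∷ (2F , 7F , anyE) ∷ [])

forbidden : List Family
forbidden = F₁ ∷ F₂ ∷ F₃ ∷ F₄ ∷ F₅ ∷ F₆ ∷ []

{-# OPTIONS --safe #-}

module Submission where

open import Defs
open import Data.Bool using (Bool; true; false; _∧_; _∨_; if_then_else_)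
open import Data.Bool.Properties using (∨-comm; ∧-comm) renaming (_≟_ to _≟ᵇ_)
open import Data.Empty using (⊥; ⊥-elim)
open import Data.Fin using (Fin; zero; suc; _≟_)
open import Data.Fin.Properties using (any?; all?)
open import Data.List using (List; []; _∷_; length; filter; allFin; cartesianProduct)
open import Data.List.Membership.Propositional using (_∈_; lose)
open import Data.List.Membership.Propositional.Properties
  using (∈-allFin; ∈-cartesianProduct⁺; ∈-filter⁺)
open import Data.List.Properties using (filter-notAll)
open import Data.List.Relation.Unary.All using (All; []; _∷_)
import Data.List.Relation.Unary.All as All
open import Data.List.Relation.Unary.Any using (here; there)
open import Data.Maybe using (Maybe; just; nothing)
open import Data.Nat using (ℕ; _<_)
open import Data.Nat.Induction using (<-wellFounded)
open import Data.Product using (∃; ∃₂; _×_; _,_; proj₁; proj₂)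
open import Data.Sum using (_⊎_; inj₁; inj₂; fromInj₁; fromInj₂; reduce)
open import Data.Unit using (⊤; tt)
open import Data.Vec using ([]; _∷_; lookup)
open import Function using (_∘_)
open import Function.Bundles using (_⇔_; mk⇔)
open import Function.Definitions using (Injective)
open import Induction.WellFounded using (Acc; acc)
open import Relation.Binary.PropositionalEquality as ≡
  using (_≡_; _≢_; refl; cong₂; subst; trans; ≢-sym)
open import Relation.Nullary using (Dec; yes; no; does; ¬_; contradiction)
open import Relation.Nullary.Decidable
  using (_×-dec_; _⊎-dec_; ¬?; dec-true; dec-false; decidable-stable; map′; True; toWitness)

-- No edge of a copy of a pattern in F₁ ∪ ⋯ ∪ F₆ is simplicial, so an elimination ordering
-- can never delete a first edge of the copy. Conversely, deleting a simplicial edge creates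
-- neither a 2K₂ nor a forbidden pattern, so it is enough to find one simplicial edge.
--
-- The underlying graph is a chain graph: on each side the neighbourhoods are nested, and its
-- maximal bicliques B₁, B₂, … are the sets N(v) × N(u) for "diagonal" edges uv, consecutive
-- ones shrinking on one side and growing on the other. If no edge is simplicial, every
-- Bᵢ is tilted one way, tilted the other way, or has a negative edge lying in both
-- neighbouring bicliques. B₁ must be tilted towards B₂; patterns F₁, …, F₅ propagate this
-- tilt from Bᵢ to Bᵢ₊₁, and opposite tilts of Bᵢ and Bᵢ₊₁ produce a forbidden pattern.
-- Since the chain is finite, this is absurd.

-- Deleting an edge

matches : ∀ {n} (u v x y : Fin n) → Bool
matches u v x y = (does (x ≟ u) ∧ does (y ≟ v)) ∨ (does (x ≟ v) ∧ does (y ≟ u))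

matches-sym : ∀ {n} (u v x y : Fin n) → matches u v x y ≡ matches u v y x
matches-sym u v x y = trans
  (∨-comm (does (x ≟ u) ∧ does (y ≟ v)) _)
  (cong₂ _∨_ (∧-comm (does (x ≟ v)) _) (∧-comm (does (x ≟ u)) _))

deleteEdge-nothing : ∀ {n} (a : Adj n) u v → deleteEdge a u v u v ≡ nothing
deleteEdge-nothing a u v
  rewrite dec-true (u ≟ u) refl | dec-true (v ≟ v) refl = refl

deleteEdge-other : ∀ {n} (a : Adj n) u v {x y} → ¬ (x ≡ u × y ≡ v) → ¬ (x ≡ v × y ≡ u) →
  deleteEdge a u v x y ≡ a x y
deleteEdge-other a u v {x} {y} p q
  rewrite dec-false ((x ≟ u) ×-dec (y ≟ v)) p | dec-false ((x ≟ v) ×-dec (y ≟ u)) q = refl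

deleteEdge-mono : ∀ {n} (a : Adj n) u v {x y} → Edge (deleteEdge a u v) x y → Edge a x y
deleteEdge-mono a u v {x} {y} e with matches u v x y
... | true  = contradiction refl e
... | false = e

delete : (G : SignedBigraph) (u v : Fin (n G)) → SignedBigraph
delete G u v = record
  { n    = n G
  ; side = side G
  ; adj  = deleteEdge (adj G) u v
  ; sym  = λ x y → cong₂ (if_then nothing else_) (matches-sym u v x y) (sym G x y)
  ; bip  = λ x y e → bip G x y (deleteEdge-mono (adj G) u v e)
  }

-- Signed bigraphs through their adjacency

≢∧≢⇒≡ : ∀ {x y z : Bool} → x ≢ z → y ≢ z → x ≡ y
≢∧≢⇒≡ {true}  {true}          p q = refl
≢∧≢⇒≡ {false} {false}         p q = refl
≢∧≢⇒≡ {true}  {false} {true}  p q = contradiction refl p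
≢∧≢⇒≡ {true}  {false} {false} p q = contradiction refl q
≢∧≢⇒≡ {false} {true}  {true}  p q = contradiction refl q
≢∧≢⇒≡ {false} {true}  {false} p q = contradiction refl p

pos? : (s : Maybe Sign) → Dec (s ≡ just pos)
pos? nothing    = no λ ()
pos? (just pos) = yes refl
pos? (just neg) = no λ ()

one-differs : ∀ {n} {P : Fin n → Set} {p q} → p ≢ q → P p → P q → ∀ x → ∃ λ r → r ≢ x × P r
one-differs {p = p} {q} p≢q Pp Pq x with p ≟ x
... | yes refl = q , ≢-sym p≢q , Pq
... | no p≢x   = p , p≢x , Pp

module Graph (G : SignedBigraph) where

  V : Set
  V = Fin (n G)

  infix 4 _~_ _⊖_ _~?_ _⊖?_

  _~_ _⊖_ : V → V → Set
  x ~ y = adj G x y ≢ nothing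
  x ⊖ y = adj G x y ≡ just neg

  _~?_ : ∀ x y → Dec (x ~ y)
  x ~? y with adj G x y
  ... | nothing = no λ e → e refl
  ... | just _  = yes λ ()

  _⊖?_ : ∀ x y → Dec (x ⊖ y)
  x ⊖? y with adj G x y
  ... | nothing  = no λ ()
  ... | just pos = no λ ()
  ... | just neg = yes refl

  ~-sym : ∀ {x y} → x ~ y → y ~ x
  ~-sym {x} {y} e p = e (trans (sym G x y) p)

  ⊖-sym : ∀ {x y} → x ⊖ y → y ⊖ x
  ⊖-sym {x} {y} = trans (sym G y x)

  ⊖⇒~ : ∀ {x y} → x ⊖ y → x ~ y
  ⊖⇒~ e p with () ← trans (≡.sym e) p

  ≁⇒nothing : ∀ {x y} → ¬ x ~ y → adj G x y ≡ nothing
  ≁⇒nothing {x} {y} p with adj G x y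
  ... | nothing = refl
  ... | just _  = contradiction (λ ()) p

  ~⇒sides : ∀ {x y} → x ~ y → side G x ≢ side G y
  ~⇒sides = bip G _ _

  same-side : ∀ {x y z} → x ~ z → y ~ z → side G x ≡ side G y
  same-side p q = ≢∧≢⇒≡ (~⇒sides p) (~⇒sides q)

  same-side⇒≁ : ∀ {x y} → side G x ≡ side G y → adj G x y ≡ nothing
  same-side⇒≁ p = ≁⇒nothing λ e → ~⇒sides e p

  ~⇒≢ : ∀ {x y} → x ~ y → x ≢ y
  ~⇒≢ e refl = ~⇒sides e refl

  separated : ∀ {x y z} → x ~ z → ¬ y ~ z → x ≢ y
  separated p q refl = q p

  -- The failure of an edge to be signed simplicial, with sides expressed through adjacency: `x ~ v`
  -- puts `x` on the side of `u`. No reference to X or Y remains, so `u` and `v` can be swapped.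
  record Obstruction (u v : V) : Set where
    constructor obstruction
    field
      {x y} : V
      x~v   : x ~ v
      y~u   : y ~ u
      x≢u   : x ≢ u
      y≢v   : y ≢ v
      ≢pos  : adj G x y ≢ just pos

  obstruction? : ∀ u v → Dec (Obstruction u v)
  obstruction? u v = map′
    (λ (_ , _ , p , q , r , s , t) → obstruction p q r s t)
    (λ { (obstruction p q r s t) → _ , _ , p , q , r , s , t })
    (any? λ x → any? λ y →
      (x ~? v) ×-dec (y ~? u) ×-dec ¬? (x ≟ u) ×-dec ¬? (y ≟ v) ×-dec ¬? (pos? (adj G x y)))

  unobstructed⇒simplicial : ∀ {u v} → u ~ v → ¬ Obstruction u v →
    SignedSimplicial (side G) (adj G) u v
  unobstructed⇒simplicial {u} {v} u~v ¬o x y (ux , x≢u , x≢v) (uy , y≢u , y≢v) sx sy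
    with ux | uy
  ... | inj₁ u~x | inj₁ u~y with () ← trans (≡.sym sx) (trans (same-side (~-sym u~x) (~-sym u~y)) sy)
  ... | inj₂ v~x | inj₂ v~y with () ← trans (≡.sym sx) (trans (same-side (~-sym v~x) (~-sym v~y)) sy)
  ... | inj₁ u~x | inj₂ v~y = trans (sym G x y)
    (decidable-stable (pos? _) (λ p → ¬o (obstruction (~-sym v~y) (~-sym u~x) y≢u x≢v p)))
  ... | inj₂ v~x | inj₁ u~y =
    decidable-stable (pos? _) (λ p → ¬o (obstruction (~-sym v~x) (~-sym u~y) x≢u y≢v p))

  simplicial⇒unobstructed : ∀ {u v} → u ~ v → SignedSimplicial (side G) (adj G) u v →
    ¬ Obstruction u v
  simplicial⇒unobstructed {u} {v} u~v simp (obstruction {x} {y} x~v y~u x≢u y≢v ≢pos)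
    with side G x in sx | side G y in sy
  ... | false | true  = ≢pos (simp x y x∈ y∈ sx sy)
    where
    x∈ = inj₂ (~-sym x~v) , x≢u , ~⇒≢ x~v
    y∈ = inj₁ (~-sym y~u) , ~⇒≢ y~u , y≢v
  ... | true  | false = ≢pos (trans (sym G x y) (simp y x y∈ x∈ sy sx))
    where
    x∈ = inj₂ (~-sym x~v) , x≢u , ~⇒≢ x~v
    y∈ = inj₁ (~-sym y~u) , ~⇒≢ y~u , y≢v
  ... | true  | true  = ~⇒sides u~v (trans (same-side u~v x~v)
    (trans sx (trans (≡.sym sy) (same-side y~u (~-sym u~v)))))
  ... | false | false = ~⇒sides u~v (trans (same-side u~v x~v)
    (trans sx (trans (≡.sym sy) (same-side y~u (~-sym u~v)))))

-- Deleting a simplicial edge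

module Deletion (G : SignedBigraph) {u v : Fin (n G)} (u~v : Edge (adj G) u v)
  (simp : SignedSimplicial (side G) (adj G) u v) where

  open Graph G
  private module D = Graph (delete G u v)

  persists : ∀ {x y} → x ≢ u → x ≢ v → adj (delete G u v) x y ≡ adj G x y
  persists p q = deleteEdge-other (adj G) u v (p ∘ proj₁) (q ∘ proj₁)

  private
    lift : ∀ {x y} → x D.~ y → x ~ y
    lift = deleteEdge-mono (adj G) u v

    lift≁ : ∀ {x y} → adj (delete G u v) x y ≡ nothing → x ≢ u → x ≢ v → adj G x y ≢ just pos
    lift≁ e p q r with () ← trans (≡.sym e) (trans (persists p q) r)

    -- If `a`, `d` were the ends of the deleted edge, then `b` and `c` would lie in its
    -- neighbourhood without a positive edge between them, obstructing it.
    new-2K₂ : ∀ {a b c d} → a ≢ b → a ≢ c → b ≢ d → c ≢ d → a D.~ b → c D.~ d →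
      adj (delete G u v) a d ≡ nothing → adj (delete G u v) b c ≡ nothing → adj G a d ≡ nothing
    new-2K₂ {a} {b} {c} {d} a≢b a≢c b≢d c≢d a~b c~d a≁d b≁c
      with (a ≟ u) ×-dec (d ≟ v) | (a ≟ v) ×-dec (d ≟ u)
    ... | no p | no q = trans (≡.sym (deleteEdge-other (adj G) u v p q)) a≁d
    ... | yes (refl , refl) | _ = contradiction
      (obstruction (lift c~d) (~-sym (lift a~b)) (≢-sym a≢c) b≢d
        (lift≁ b≁c (≢-sym a≢b) b≢d ∘ trans (sym G b c)))
      (simplicial⇒unobstructed u~v simp)
    ... | no _ | yes (refl , refl) = contradiction
      (obstruction (~-sym (lift a~b)) (lift c~d) b≢d (≢-sym a≢c)
        (lift≁ b≁c b≢d (≢-sym a≢b)))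
      (simplicial⇒unobstructed u~v simp)

  delete-nonSeparable : NonSeparable G → NonSeparable (delete G u v)
  delete-nonSeparable ns a b c d a≢b a≢c a≢d b≢c b≢d c≢d a~b c~d (ac , ad , bc , bd) =
    ns a b c d a≢b a≢c a≢d b≢c b≢d c≢d
      (lift a~b) (lift c~d)
      ( new-2K₂ a≢b a≢d b≢c d≢c a~b d~c ac bd
      , new-2K₂ a≢b a≢c b≢d c≢d a~b c~d ad bc
      , new-2K₂ b≢a b≢d a≢c d≢c b~a d~c bc ad
      , new-2K₂ b≢a b≢c a≢d c≢d b~a c~d bd ac )
    where
    b≢a = ≢-sym a≢b
    d≢c = ≢-sym c≢d
    b~a = D.~-sym a~b
    d~c = D.~-sym c~d

-- Forbidden patterns

-- What a label guarantees whatever signs are chosen for the arbitrary edges.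
Present NonPositive : Label → Set
Present none = ⊥
Present negE = ⊤
Present anyE = ⊤
NonPositive none = ⊤
NonPositive negE = ⊤
NonPositive anyE = ⊥

present? : ∀ l → Dec (Present l)
present? none = no λ ()
present? negE = yes tt
present? anyE = yes tt

none? : ∀ l → Dec (l ≡ none)
none? none = yes refl
none? negE = no λ ()
none? anyE = no λ ()

nonPositive? : ∀ l → Dec (NonPositive l)
nonPositive? none = yes tt
nonPositive? negE = yes tt
nonPositive? anyE = no λ ()

present⇒edge : ∀ {l s} → Conforms l s → Present l → s ≢ nothing
present⇒edge {anyE} {just _} _ _ ()
present⇒edge {negE} refl _ ()

nonPositive⇒≢pos : ∀ {l s} → Conforms l s → NonPositive l → s ≢ just pos
nonPositive⇒≢pos {none} refl _ ()
nonPositive⇒≢pos {negE} refl _ ()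

module Pattern (F : Family) where
  open Family F public renaming (size to k)

  label : Fin k → Fin k → Label
  label = patternOf edges

  loopless? : Dec (∀ i → label i i ≡ none)
  loopless? = all? λ i → none? (label i i)

  -- Whether or not i and j are adjacent in a copy of the pattern, no supergraph in
  -- which they are adjacent and which agrees with the copy elsewhere makes them a
  -- simplicial edge: this covers both the edges and the non-edges of the pattern.
  Blocked : Fin k → Fin k → Set
  Blocked i j =
      (∃₂ λ x y → x ≢ i × y ≢ j × Present (label x j) × Present (label y i) × NonPositive (label x y))
    ⊎ (∃ λ m → Present (label i m) × Present (label j m))

  -- The edge asked for first ensures that the empty list is not an ordering of a graph containing
  -- the pattern.
  Resilient : Set
  Resilient = (∃₂ λ i j → Present (label i j)) × (∀ i j → Blocked i j)

  resilient? : Dec Resilient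
  resilient? =
    (any? λ i → any? λ j → present? (label i j)) ×-dec
    (all? λ i → all? λ j →
      (any? λ x → any? λ y → ¬? (x ≟ i) ×-dec ¬? (y ≟ j) ×-dec present? (label x j)
        ×-dec present? (label y i) ×-dec nonPositive? (label x y))
      ⊎-dec (any? λ m → present? (label i m) ×-dec present? (label j m)))

open Pattern using (Resilient)

abstract
  -- A finite check, done by evaluating `resilient?`; `abstract` keeps its result from being
  -- unfolded later.
  forbidden-resilient : All Resilient forbidden
  forbidden-resilient = toWitness {a? = All.all? Pattern.resilient? forbidden} tt


-- Copies of a pattern under deletion

module Copy {F : Family} (resilient : Resilient F) {H : Adj (Family.size F)} (H∈F : Member F H) where
  open Pattern F hiding (Resilient)

  present : ∀ {i j} → Present (label i j) → Edge H i j
  present = present⇒edge (H∈F _ _)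

  -- Inclusion, with agreement away from `f i` and `f j`, is all that is assumed, so this applies to
  -- an induced copy and also to one that becomes induced only once that edge is deleted. A common
  -- neighbour would put both ends on one side; otherwise `Blocked` supplies an obstruction.
  not-simplicial : ∀ G {f : Fin k → Fin (n G)} → Injective _≡_ _≡_ f → ∀ {i j} →
    (∀ x y → Edge H x y → Edge (adj G) (f x) (f y)) →
    (∀ x y → f x ≢ f i → f x ≢ f j → H x y ≡ adj G (f x) (f y)) →
    Edge (adj G) (f i) (f j) → ¬ SignedSimplicial (side G) (adj G) (f i) (f j)
  not-simplicial G {f} inj {i} {j} mono agree i~j simp with proj₂ resilient i j
  ... | inj₂ (m , im , jm) = ~⇒sides i~j (same-side (mono _ _ (present im)) (mono _ _ (present jm)))
    where open Graph G
  ... | inj₁ (x , y , x≢i , y≢j , xj , yi , xy) = simplicial⇒unobstructed i~j simp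
    (obstruction x~j (mono y i (present yi)) (x≢i ∘ inj) (y≢j ∘ inj)
      (nonPositive⇒≢pos (H∈F x y) xy ∘ trans (agree x y (x≢i ∘ inj) (~⇒≢ x~j))))
    where
    open Graph G
    x~j = mono x j (present xj)

  -- A deleted edge with at most one end in the copy changes no pair of the copy.
  outside-or-inside : ∀ G {u v} (f : Fin k → Fin (n G)) →
    (∀ i j → deleteEdge (adj G) u v (f i) (f j) ≡ adj G (f i) (f j)) ⊎
    (∃₂ λ i j → f i ≡ u × f j ≡ v)
  outside-or-inside G {u} {v} f with any? (λ i → f i ≟ u) | any? (λ j → f j ≟ v)
  ... | yes (i , p) | yes (j , q) = inj₂ (i , j , p , q)
  ... | no p | _ = inj₁ λ i j →
    deleteEdge-other (adj G) u v (λ (q , _) → p (i , q)) (λ (_ , q) → p (j , q))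
  ... | _ | no p = inj₁ λ i j →
    deleteEdge-other (adj G) u v (λ (_ , q) → p (j , q)) (λ (q , _) → p (i , q))

  no-ordering : ∀ G {f : Fin k → Fin (n G)} → Injective _≡_ _≡_ f →
    (∀ i j → adj G (f i) (f j) ≡ H i j) → ∀ es → ¬ IsOrdering (side G) (adj G) es
  no-ordering G {f} inj eq [] noEdges with proj₁ resilient
  ... | i , j , ij = present ij (trans (≡.sym (eq i j)) (noEdges (f i) (f j)))
  no-ordering G {f} inj eq ((u , v) ∷ es) (u~v , simp , ord) with outside-or-inside G {u} {v} f
  ... | inj₁ same = no-ordering (delete G u v) inj (λ i j → trans (same i j) (eq i j)) es ord
  ... | inj₂ (i , j , refl , refl) = not-simplicial G inj
    (λ x y e p → e (trans (≡.sym (eq x y)) p)) (λ x y _ _ → ≡.sym (eq x y)) u~v simp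

-- If the copy contained both ends of the deleted edge, restoring that edge would leave it blocked
-- by the rest of the copy, hence not simplicial.
contains-before-deletion : ∀ G {F u v} → Resilient F → Edge (adj G) u v →
  SignedSimplicial (side G) (adj G) u v →
  ContainsMemberOf (delete G u v) F → ContainsMemberOf G F
contains-before-deletion G {F} {u} {v} resilient u~v simp (H , H∈F , f , inj , eq)
  with Copy.outside-or-inside {F} resilient H∈F G {u} {v} f
... | inj₁ same = H , H∈F , f , inj , λ i j → trans (≡.sym (same i j)) (eq i j)
... | inj₂ (i , j , refl , refl) = contradiction simp
  (Copy.not-simplicial {F} resilient H∈F G inj
    (λ x y e → deleteEdge-mono (adj G) u v (e ∘ trans (≡.sym (eq x y))))
    (λ x y p q → trans (≡.sym (eq x y)) (Deletion.persists G u~v simp p q)) u~v)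

-- Embedding a pattern

Entries : ∀ k → (Fin k → Set) → Set
Entries ℕ.zero    P = ⊤
Entries (ℕ.suc k) P = P zero × Entries k (P ∘ suc)

entry : ∀ {k} {P : Fin k → Set} → Entries k P → ∀ i → P i
entry (p , ps) zero    = p
entry (p , ps) (suc i) = entry ps i

-- Data for the pairs `i < j` as nested tuples, so that an embedding is verified once per unordered
-- pair.
UpperTriangle : ∀ k → (Fin k → Fin k → Set) → Set
UpperTriangle ℕ.zero    R = ⊤
UpperTriangle (ℕ.suc k) R = Entries k (R zero ∘ suc) × UpperTriangle k (λ i j → R (suc i) (suc j))

upperTriangle : ∀ {k} {R S : Fin k → Fin k → Set} → (∀ {i j} → R i j → S i j) →
  (∀ {i j} → S i j → S j i) → (∀ i → S i i) → UpperTriangle k R → ∀ i j → S i j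
upperTriangle f s r (ps , qs) zero    zero    = r zero
upperTriangle f s r (ps , qs) zero    (suc j) = f (entry ps j)
upperTriangle f s r (ps , qs) (suc i) zero    = s (f (entry ps i))
upperTriangle f s r (ps , qs) (suc i) (suc j) = upperTriangle f s (r ∘ suc) qs i j

patternOf-sym : ∀ {k} (es : List (Fin k × Fin k × Label)) x y → patternOf es x y ≡ patternOf es y x
patternOf-sym []                 x y = refl
patternOf-sym ((u , v , l) ∷ es) x y =
  cong₂ (if_then l else_) (matches-sym u v x y) (patternOf-sym es x y)

conforms-any : ∀ {s} → s ≢ nothing → Conforms anyE s
conforms-any {nothing} e = e refl
conforms-any {just _}  e = tt

module Embedding (G : SignedBigraph) where
  open Graph G

  -- Distinctness travels with the label, so the same table also yields injectivity of the
  -- embedding.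
  Fits : Label → V → V → Set
  Fits l x y = x ≢ y × Conforms l (adj G x y)

  fits-neg : ∀ {x y} → x ⊖ y → Fits negE x y
  fits-neg e = ~⇒≢ (⊖⇒~ e) , e

  fits-any : ∀ {x y} → x ~ y → Fits anyE x y
  fits-any e = ~⇒≢ e , conforms-any e

  fits-apart : ∀ {x y z} → x ~ z → side G y ≡ side G z → ¬ x ~ y → Fits none x y
  fits-apart p q x≁y = (λ { refl → ~⇒sides p q }) , ≁⇒nothing x≁y

  fits-same-side : ∀ {x y z} → x ~ z → y ~ z → x ≢ y → Fits none x y
  fits-same-side p q x≢y = x≢y , same-side⇒≁ (same-side p q)

  module _ (F : Family) (f : Fin (Family.size F) → V) where
    open Pattern F

    embed : {_ : True loopless?} →
      UpperTriangle k (λ i j → Fits (label i j) (f i) (f j)) → ContainsMemberOf G F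
    embed {loopless} fits = _ , (λ i j → proj₂ (all i j)) , f , injective , λ _ _ → refl
      where
      Related : Fin k → Fin k → Set
      Related i j = (f i ≡ f j → i ≡ j) × Conforms (label i j) (adj G (f i) (f j))

      related-sym : ∀ {i j} → Related i j → Related j i
      related-sym {i} {j} (p , q) =
        ≡.sym ∘ p ∘ ≡.sym , subst (λ l → Conforms l _) (patternOf-sym edges i j)
          (subst (Conforms (label i j)) (sym G (f i) (f j)) q)

      all : ∀ i j → Related i j
      all = upperTriangle (λ (p , q) → (λ e → contradiction e p) , q) related-sym
        (λ i → (λ _ → refl) , subst (λ l → Conforms l _) (≡.sym (toWitness loopless i)) (same-side⇒≁ refl))
        fits

      injective : Injective _≡_ _≡_ f
      injective = proj₁ (all _ _)

-- Configurations excluded by the six patterns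

module ForbiddenFree (G : SignedBigraph) (free : All (λ F → ¬ ContainsMemberOf G F) forbidden) where
  open Graph G
  open Embedding G

  no-F₁ : ∀ {a b p q} → a ≢ b → p ≢ q → a ⊖ p → a ⊖ q → b ⊖ p → b ⊖ q → ⊥
  no-F₁ {a} {b} {p} {q} a≢b p≢q ap aq bp bq = All.lookup free (here refl)
    (embed F₁ (lookup (a ∷ b ∷ p ∷ q ∷ []))
      ( (fits-same-side (⊖⇒~ ap) (⊖⇒~ bp) a≢b , fits-neg ap , fits-neg aq , tt)
      , (fits-neg bp , fits-neg bq , tt)
      , (fits-same-side (~-sym (⊖⇒~ ap)) (~-sym (⊖⇒~ aq)) p≢q , tt)
      , _ ))

  no-F₂ : ∀ {a b p q r} → a ≢ b → p ≢ q → p ≢ r → q ≢ r →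
    a ⊖ p → a ⊖ q → a ~ r → b ~ p → b ⊖ q → b ⊖ r → ⊥
  no-F₂ {a} {b} {p} {q} {r} a≢b p≢q p≢r q≢r ap aq ar bp bq br = All.lookup free (there (here refl))
    (embed F₂ (lookup (a ∷ b ∷ p ∷ q ∷ r ∷ []))
      ( (fits-same-side ar (⊖⇒~ br) a≢b , fits-neg ap , fits-neg aq , fits-any ar , tt)
      , (fits-any bp , fits-neg bq , fits-neg br , tt)
      , (fits-same-side (~-sym (⊖⇒~ ap)) (~-sym (⊖⇒~ aq)) p≢q , fits-same-side (~-sym (⊖⇒~ ap)) (~-sym ar) p≢r , tt)
      , (fits-same-side (~-sym (⊖⇒~ aq)) (~-sym ar) q≢r , tt)
      , _ ))

  no-F₃ : ∀ {a b p q r s} → a ≢ b → p ≢ q → p ≢ r → p ≢ s → q ≢ r → q ≢ s → r ≢ s →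
    a ⊖ p → a ⊖ q → a ~ r → a ~ s → b ~ p → b ~ q → b ⊖ r → b ⊖ s → ⊥
  no-F₃ {a} {b} {p} {q} {r} {s} a≢b p≢q p≢r p≢s q≢r q≢s r≢s ap aq ar as bp bq br bs =
    All.lookup free (there (there (here refl)))
    (embed F₃ (lookup (a ∷ b ∷ p ∷ q ∷ r ∷ s ∷ []))
      ( (fits-same-side ar (⊖⇒~ br) a≢b , fits-neg ap , fits-neg aq , fits-any ar , fits-any as , tt)
      , (fits-any bp , fits-any bq , fits-neg br , fits-neg bs , tt)
      , (fits-same-side pa qa p≢q , fits-same-side pa ra p≢r , fits-same-side pa sa p≢s , tt)
      , (fits-same-side qa ra q≢r , fits-same-side qa sa q≢s , tt)
      , (fits-same-side ra sa r≢s , tt)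
      , _ ))
    where
    pa = ~-sym (⊖⇒~ ap)
    qa = ~-sym (⊖⇒~ aq)
    ra = ~-sym ar
    sa = ~-sym as

  no-F₄ : ∀ {a b c p q r} → a ≢ b → a ≢ c → b ≢ c → p ≢ q → p ≢ r → q ≢ r →
    a ⊖ p → a ~ q → a ~ r → b ~ p → b ⊖ q → b ~ r → c ~ p → c ~ q → c ⊖ r → ⊥
  no-F₄ {a} {b} {c} {p} {q} {r} a≢b a≢c b≢c p≢q p≢r q≢r ap aq ar bp bq br cp cq cr =
    All.lookup free (there (there (there (here refl))))
    (embed F₄ (lookup (a ∷ b ∷ c ∷ p ∷ q ∷ r ∷ []))
      ( (fits-same-side ar br a≢b , fits-same-side aq cq a≢c , fits-neg ap , fits-any aq , fits-any ar , tt)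
      , (fits-same-side bp cp b≢c , fits-any bp , fits-neg bq , fits-any br , tt)
      , (fits-any cp , fits-any cq , fits-neg cr , tt)
      , (fits-same-side (~-sym cp) (~-sym cq) p≢q , fits-same-side (~-sym bp) (~-sym br) p≢r , tt)
      , (fits-same-side (~-sym aq) (~-sym ar) q≢r , tt)
      , _ ))

  -- The remaining distinctness conditions follow from the non-edge `ar`, since `b`, `c` are
  -- adjacent to `r` and `p`, `q` to `a`.
  no-F₅ : ∀ {a b c p q r} → b ≢ c → p ≢ q →
    a ~ p → a ~ q → ¬ a ~ r → b ⊖ p → b ~ q → b ~ r → c ~ p → c ⊖ q → c ~ r → ⊥
  no-F₅ {a} {b} {c} {p} {q} {r} b≢c p≢q ap aq ar bp bq br cp cq cr =
    All.lookup free (there (there (there (there (here refl)))))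
    (embed F₅ (lookup (a ∷ b ∷ c ∷ p ∷ q ∷ r ∷ []))
      ( (fits-same-side aq bq (≢-sym (separated br ar)) , fits-same-side ap cp (≢-sym (separated cr ar))
        , fits-any ap , fits-any aq , fits-apart ap (same-side (~-sym cr) (~-sym cp)) ar , tt)
      , (fits-same-side br cr b≢c , fits-neg bp , fits-any bq , fits-any br , tt)
      , (fits-any cp , fits-neg cq , fits-any cr , tt)
      , (fits-same-side (~-sym ap) (~-sym aq) p≢q
        , fits-same-side (~-sym cp) (~-sym cr) (separated (~-sym ap) (ar ∘ ~-sym)) , tt)
      , (fits-same-side (~-sym bq) (~-sym br) (separated (~-sym aq) (ar ∘ ~-sym)) , tt)
      , _ ))

  no-F₆ : ∀ {a b c d p q r s} → a ≢ b → c ≢ d → p ≢ q → r ≢ s →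
    a ⊖ p → a ~ q → ¬ a ~ r → ¬ a ~ s →
    b ⊖ p → b ~ q → ¬ b ~ r → ¬ b ~ s →
    c ~ p → c ⊖ q → c ~ r → c ~ s →
    d ~ p → d ~ q → d ⊖ r → d ⊖ s → ⊥
  no-F₆ {a} {b} {c} {d} {p} {q} {r} {s} a≢b c≢d p≢q r≢s ap aq ar as bp bq br bs cp cq cr cs dp dq dr ds =
    All.lookup free (there (there (there (there (there (here refl))))))
    (embed F₆ (lookup (a ∷ b ∷ c ∷ d ∷ p ∷ q ∷ r ∷ s ∷ []))
      ( (fits-same-side aq bq a≢b , fits-same-side (⊖⇒~ ap) cp (≢-sym (separated cr ar))
        , fits-same-side aq dq (≢-sym (separated (⊖⇒~ dr) ar))
        , fits-neg ap , fits-any aq , fits-apart aq rq ar , fits-apart aq sq as , tt)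
      , (fits-same-side (⊖⇒~ bp) cp (≢-sym (separated cr br))
        , fits-same-side bq dq (≢-sym (separated (⊖⇒~ dr) br))
        , fits-neg bp , fits-any bq , fits-apart bq rq br , fits-apart bq sq bs , tt)
      , (fits-same-side cp dp c≢d , fits-any cp , fits-neg cq , fits-any cr , fits-any cs , tt)
      , (fits-any dp , fits-any dq , fits-neg dr , fits-neg ds , tt)
      , (fits-same-side (~-sym dp) (~-sym dq) p≢q
        , fits-same-side (~-sym cp) (~-sym cr) (separated (~-sym (⊖⇒~ ap)) (ar ∘ ~-sym))
        , fits-same-side (~-sym cp) (~-sym cs) (separated (~-sym (⊖⇒~ ap)) (as ∘ ~-sym)) , tt)
      , (fits-same-side (~-sym dq) (~-sym (⊖⇒~ dr)) (separated (~-sym aq) (ar ∘ ~-sym))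
        , fits-same-side (~-sym dq) (~-sym (⊖⇒~ ds)) (separated (~-sym aq) (as ∘ ~-sym)) , tt)
      , (fits-same-side (~-sym cr) (~-sym cs) r≢s , tt)
      , _ ))
    where
    rq = same-side (~-sym (⊖⇒~ dr)) (~-sym dq)
    sq = same-side (~-sym (⊖⇒~ ds)) (~-sym dq)

  -- The leaf sets share two, one or no vertices, which gives F₁, F₂ or F₃ respectively.
  two-negative-stars : ∀ {a b p q r s} → a ≢ b → p ≢ q → r ≢ s →
    a ⊖ p → a ⊖ q → b ⊖ r → b ⊖ s → b ~ p → b ~ q → a ~ r → a ~ s → ⊥
  two-negative-stars {p = p} {q} {r} {s} a≢b p≢q r≢s ap aq br bs bp bq ar as
    with p ≟ r | p ≟ s | q ≟ r | q ≟ s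
  ... | yes refl | yes refl | _        | _        = r≢s refl
  ... | _        | _        | yes refl | yes refl = r≢s refl
  ... | yes refl | _        | yes refl | _        = p≢q refl
  ... | _        | yes refl | _        | yes refl = p≢q refl
  ... | yes refl | no _     | no _     | yes refl = no-F₁ a≢b p≢q ap aq br bs
  ... | no _     | yes refl | yes refl | no _     = no-F₁ a≢b p≢q ap aq bs br
  ... | yes refl | no _     | no _     | no q≢s   = no-F₂ a≢b (≢-sym p≢q) q≢s r≢s aq ap as bq br bs
  ... | no _     | yes refl | no q≢r   | no _     = no-F₂ a≢b (≢-sym p≢q) q≢r (≢-sym r≢s) aq ap ar bq bs br
  ... | no _     | no p≢s   | yes refl | no _     = no-F₂ a≢b p≢q p≢s r≢s ap aq as bp br bs
  ... | no p≢r   | no _     | no _     | yes refl = no-F₂ a≢b p≢q p≢r (≢-sym r≢s) ap aq ar bp bs br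
  ... | no p≢r   | no p≢s   | no q≢r   | no q≢s   =
    no-F₃ a≢b p≢q p≢r p≢s q≢r q≢s r≢s ap aq ar as bp bq br bs

-- Existence of a simplicial edge

module Minimum {A : Set} {P : A → Set} (P? : ∀ x → Dec (P x)) {_≼_ : A → A → Set}
  (total : ∀ {x y} → P x → P y → x ≼ y ⊎ y ≼ x) (≼-trans : ∀ {x y z} → x ≼ y → y ≼ z → x ≼ z) where

  -- `m₀` is the running minimum; returning `m ≼ m₀` lets transitivity handle the candidates already
  -- compared.
  minimum : ∀ xs {m₀} → P m₀ → ∃ λ m → P m × m ≼ m₀ × (∀ {x} → x ∈ xs → P x → m ≼ x)
  -- Reflexivity is obtained from totality.
  minimum []       {m₀} p = m₀ , p , reduce (total p p) , λ ()
  minimum (x ∷ xs) {m₀} p with P? x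
  ... | no ¬px with minimum xs p
  ...   | m , pm , m≼m₀ , m≼ = m , pm , m≼m₀ , λ
    { (here refl) px → contradiction px ¬px ; (there x∈xs) px → m≼ x∈xs px }
  minimum (x ∷ xs) {m₀} p | yes px with total p px
  ... | inj₁ m₀≼x with minimum xs p
  ...   | m , pm , m≼m₀ , m≼ = m , pm , m≼m₀ , λ
    { (here refl) _ → ≼-trans m≼m₀ m₀≼x ; (there x∈xs) px → m≼ x∈xs px }
  minimum (x ∷ xs) {m₀} p | yes px | inj₂ x≼m₀ with minimum xs px
  ...   | m , pm , m≼x , m≼ = m , pm , ≼-trans m≼x x≼m₀ , λ
    { (here refl) _ → m≼x ; (there x∈xs) px → m≼ x∈xs px }

module Obstructed (G : SignedBigraph) (nonSeparable : NonSeparable G)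
  (free : All (λ F → ¬ ContainsMemberOf G F) forbidden)
  (obstructed : ∀ {u v} → Graph._~_ G u v → Graph.Obstruction G u v) where

  open Graph G
  open ForbiddenFree G free

  ~∧≢pos⇒⊖ : ∀ {x y} → x ~ y → adj G x y ≢ just pos → x ⊖ y
  ~∧≢pos⇒⊖ {x} {y} p q with adj G x y
  ... | nothing  = contradiction refl p
  ... | just pos = contradiction refl q
  ... | just neg = refl

  -- Otherwise the two edges would form an induced 2K₂.
  nested : ∀ {x y x′ y′} → side G x ≡ side G x′ → x ~ y → x′ ~ y′ → x ~ y′ ⊎ x′ ~ y
  nested {x} {y} {x′} {y′} s xy x′y′ with x ~? y′ | x′ ~? y
  ... | yes p | _     = inj₁ p
  ... | _     | yes p = inj₂ p
  ... | no p  | no q  = ⊥-elim (nonSeparable x y x′ y′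
    (~⇒≢ xy) (separated xy q) (λ { refl → ~⇒sides x′y′ (≡.sym s) })
    (λ { refl → ~⇒sides xy s }) (separated (~-sym xy) (p ∘ ~-sym)) (~⇒≢ x′y′)
    xy x′y′
    ( same-side⇒≁ s , ≁⇒nothing p , ≁⇒nothing (q ∘ ~-sym)
    , same-side⇒≁ (≢∧≢⇒≡ (≢-sym (~⇒sides xy)) (λ e → ~⇒sides x′y′ (trans (≡.sym s) (≡.sym e))))))

  _⊑_ : V → V → Set
  x ⊑ y = ∀ {z} → x ~ z → y ~ z

  -- For `x` on the side of `u`, nestedness turns this into strict inclusion of N(u) in N(x).
  Above : V → V → Set
  Above u x = ∃ λ z → x ~ z × ¬ u ~ z

  above? : ∀ u x → Dec (Above u x)
  above? u x = any? λ z → (x ~? z) ×-dec ¬? (u ~? z)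

  ¬above⇒~ : ∀ {u x z} → ¬ Above u x → x ~ z → u ~ z
  ¬above⇒~ {u} {z = z} ¬a x~z = decidable-stable (u ~? z) λ u≁z → ¬a (z , x~z , u≁z)

  ⊑-total : ∀ {x y} → side G x ≡ side G y → (x ⊑ y) ⊎ (y ⊑ x)
  ⊑-total {x} {y} s with above? y x
  ... | no ¬a = inj₁ (¬above⇒~ ¬a)
  ... | yes (z , x~z , y≁z) = inj₂ λ y~w → fromInj₁ (⊥-elim ∘ y≁z) (nested s x~z y~w)

  -- Diagonal edges and their bicliques

  record Diagonal (u v : V) : Set where
    field
      u~v      : u ~ v
      biclique : ∀ {x y} → x ~ v → y ~ u → x ~ y

    biclique-sym : ∀ {x y} → x ~ v → y ~ u → y ~ x
    biclique-sym p q = ~-sym (biclique p q)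

  open Diagonal

  diagonal-sym : ∀ {u v} → Diagonal u v → Diagonal v u
  diagonal-sym d = record { u~v = ~-sym (u~v d) ; biclique = λ p q → ~-sym (biclique d q p) }

  -- An edge as low as (u , v) spans the same biclique, so its obstruction is negative.
  avoiding : ∀ {u v a c} → Diagonal u v → a ~ v → ¬ Above u a → c ~ u → ¬ Above v c →
    ∃₂ λ s t → s ~ v × t ~ u × s ≢ a × t ≢ c × s ⊖ t
  avoiding d a~v ¬a c~u ¬c with obstructed (biclique d a~v c~u)
  ... | obstruction s~c t~a s≢a t≢c ≢pos =
    _ , _ , s~v , t~u , s≢a , t≢c , ~∧≢pos⇒⊖ (biclique d s~v t~u) ≢pos
    where
    s~v = ~-sym (¬above⇒~ ¬c (~-sym s~c))
    t~u = ~-sym (¬above⇒~ ¬a (~-sym t~a))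

  -- All nine pairs are edges of the biclique, so the matching is a copy of F₄.
  no-matching : ∀ {u v a b c p q r} → Diagonal u v →
    a ~ v → b ~ v → c ~ v → p ~ u → q ~ u → r ~ u →
    a ≢ b → a ≢ c → b ≢ c → p ≢ q → p ≢ r → q ≢ r → a ⊖ p → b ⊖ q → c ⊖ r → ⊥
  no-matching d a b c p q r a≢b a≢c b≢c p≢q p≢r q≢r ap bq cr =
    no-F₄ a≢b a≢c b≢c p≢q p≢r q≢r ap (biclique d a q) (biclique d a r) (biclique d b p) bq
      (biclique d b r) (biclique d c p) (biclique d c q) cr

  no-two-stars : ∀ {u v a b p q r s} → Diagonal u v →
    a ~ v → b ~ v → p ~ u → q ~ u → r ~ u → s ~ u →
    a ≢ b → p ≢ q → r ≢ s → a ⊖ p → a ⊖ q → b ⊖ r → b ⊖ s → ⊥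
  no-two-stars d a b p q r s a≢b p≢q r≢s ap aq br bs =
    two-negative-stars a≢b p≢q r≢s ap aq br bs
      (biclique d b p) (biclique d b q) (biclique d a r) (biclique d a s)

  -- The nested neighbourhoods of s and s′ share a vertex outside N(u), which with u gives F₅.
  above-disjoint : ∀ {u v s s′ t t′} → Diagonal u v → s ~ v → s′ ~ v → t ~ u → t′ ~ u →
    Above u s → Above u s′ → s ≢ s′ → t ≢ t′ → s ⊖ t → s′ ⊖ t′ → ⊥
  above-disjoint d s s′ t t′ (z , sz , uz) (z′ , s′z′ , uz′) s≢s′ t≢t′ st s′t′
    with nested (same-side s s′) sz s′z′
  ... | inj₁ sz′ = no-F₅ s≢s′ t≢t′ (~-sym t) (~-sym t′) uz′ st (biclique d s t′) sz′ (biclique d s′ t) s′t′ s′z′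
  ... | inj₂ s′z = no-F₅ s≢s′ t≢t′ (~-sym t) (~-sym t′) uz st (biclique d s t′) sz (biclique d s′ t) s′t′ s′z

  -- The vertex x also lies in the next biclique of the chain. The tilt of the opposite kind
  -- is Tilted v u; in a fork, b and b′ need only be adjacent to q, so that the same witnesses
  -- serve for later bicliques that b and b′ do not belong to.
  data Tilted (u v : V) : Set where
    star : ∀ {x q q′} → x ~ v → Above u x → q ~ u → q′ ~ u → q ≢ q′ → x ⊖ q → x ⊖ q′ → Tilted u v
    fork : ∀ {x q w b b′} → x ~ v → Above u x → q ~ u → w ~ u → q ≢ w → x ⊖ q →
      x ≢ b → x ≢ b′ → b ≢ b′ → b ⊖ w → b′ ⊖ w → b ~ q → b′ ~ q → Tilted u v

  -- Classification of a single biclique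

  Middle : V → V → Set
  Middle u v = ∃₂ λ s t → s ~ v × t ~ u × Above u s × Above v t × s ⊖ t

  Star : V → V → V → Set
  Star u v x = x ~ v × ∃₂ λ q q′ → q ~ u × q′ ~ u × q ≢ q′ × x ⊖ q × x ⊖ q′

  star? : ∀ u v → Dec (∃ (Star u v))
  star? u v = any? λ x → (x ~? v) ×-dec any? λ q → any? λ q′ →
    (q ~? u) ×-dec (q′ ~? u) ×-dec ¬? (q ≟ q′) ×-dec (x ⊖? q) ×-dec (x ⊖? q′)

  starless : ∀ {u v x q q′} → ¬ ∃ (Star u v) → x ~ v → q ~ u → q′ ~ u → x ⊖ q → x ⊖ q′ → q ≡ q′
  starless {q = q} {q′} ¬star x~v q~u q′~u xq xq′ =
    decidable-stable (q ≟ q′) λ q≢q′ → ¬star (_ , x~v , _ , _ , q~u , q′~u , q≢q′ , xq , xq′)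

  -- By avoiding, some negative edge st misses both centres; x or y adjacent to it by a
  -- negative edge would make two stars on one side, so st extends to a negative 3-matching.
  two-low-stars : ∀ {u v x y} → Diagonal u v → Star u v x → ¬ Above u x → Star v u y → ¬ Above v y → ⊥
  two-low-stars {u} {v} {x} {y} d (xv , q , q′ , qu , q′u , q≢q′ , xq , xq′) ¬x
    (yu , p , p′ , pv , p′v , p≢p′ , yp , yp′) ¬y
    with avoiding d xv ¬x yu ¬y
  ... | s , t , sv , tu , s≢x , t≢y , st
    with one-differs {P = λ r → x ⊖ r × r ~ u} q≢q′ (xq , qu) (xq′ , q′u) y
       | one-differs {P = λ r → y ⊖ r × r ~ v} p≢p′ (yp , pv) (yp′ , p′v) x
  ...   | r , r≢y , xr , ru | r′ , r′≢x , yr′ , r′v =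
    no-matching d xv r′v sv ru yu tu (≢-sym r′≢x) (≢-sym s≢x) (λ { refl → ¬sy (⊖-sym yr′) })
      r≢y (λ { refl → ¬xt xr }) (≢-sym t≢y) xr (⊖-sym yr′) st
    where
    ¬sy : ¬ s ⊖ y
    ¬sy sy = no-two-stars d sv xv tu yu qu q′u s≢x t≢y q≢q′ st sy xq xq′

    ¬xt : ¬ x ⊖ t
    ¬xt xt = no-two-stars (diagonal-sym d) tu yu sv xv pv p′v t≢y s≢x p≢p′ (⊖-sym st) (⊖-sym xt) yp yp′

  -- Take a negative edge `st` avoiding `x`. If `t` is above `v`, it is the centre of a fork whose
  -- `w` is `x`. If not, a further edge avoiding `x` and `t` completes `xq` and `st` to a negative
  -- 3-matching.
  low-star⇒tilted : ∀ {u v x} → Diagonal u v → Star u v x → ¬ Above u x → ¬ ∃ (Star v u) → Tilted v u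
  low-star⇒tilted {u} {v} {x} d (xv , q , q′ , qu , q′u , q≢q′ , xq , xq′) ¬x starless-v
    -- Only `x` matters here; `v`, trivially not above itself, fills the second slot.
    with avoiding d xv ¬x (~-sym (u~v d)) (λ (_ , p , ¬p) → ¬p p)
  ... | s , t , sv , tu , s≢x , t≢v , st with above? v t
  ...   | yes t↑ = fork tu t↑ sv xv s≢x (⊖-sym st) (distinct xq) (distinct xq′) q≢q′
                     (⊖-sym xq) (⊖-sym xq′) (~-sym (biclique d sv qu)) (~-sym (biclique d sv q′u))
    where
    distinct : ∀ {q} → x ⊖ q → t ≢ q
    distinct xq refl = s≢x (starless starless-v tu sv xv (⊖-sym st) (⊖-sym xq))
  ...   | no ¬t with avoiding d xv ¬x tu ¬t
  ...     | s′ , t′ , s′v , t′u , s′≢x , t′≢t , s′t′ = ⊥-elim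
    (no-matching d xv sv s′v qu tu t′u (≢-sym s≢x) (≢-sym s′≢x)
      (λ { refl → no-two-stars d sv xv tu t′u qu q′u s≢x (≢-sym t′≢t) q≢q′ st s′t′ xq xq′ })
      (λ { refl → s≢x (starless starless-v tu sv xv (⊖-sym st) (⊖-sym xq)) })
      (λ { refl → s′≢x (starless starless-v t′u s′v xv (⊖-sym s′t′) (⊖-sym xq)) })
      (≢-sym t′≢t) xq st s′t′)

  module Starless {u v} (d : Diagonal u v) (starless-u : ¬ ∃ (Star u v)) (starless-v : ¬ ∃ (Star v u)) where

    -- Without stars the negative edges of the biclique form a matching, so two of them that differ
    -- at one end differ at the other.
    disjointˡ : ∀ {s t s′ t′} → s ~ v → t ~ u → t′ ~ u → s ⊖ t → s′ ⊖ t′ → t′ ≢ t → s′ ≢ s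
    disjointˡ sv tu t′u st s′t′ t′≢t refl = t′≢t (starless starless-u sv t′u tu s′t′ st)

    disjointʳ : ∀ {s t s′ t′} → s ~ v → t ~ u → s′ ~ v → s ⊖ t → s′ ⊖ t′ → s′ ≢ s → t′ ≢ t
    disjointʳ sv tu s′v st s′t′ s′≢s refl = s′≢s (starless starless-v tu s′v sv (⊖-sym s′t′) (⊖-sym st))

    -- A negative edge avoiding both `s` and `t′` is disjoint from the two given ones, which makes a
    -- negative 3-matching.
    no-low-corner : ∀ {s t s′ t′} → s ~ v → t ~ u → s′ ~ v → t′ ~ u → s ⊖ t → s′ ⊖ t′ →
      s′ ≢ s → t′ ≢ t → ¬ Above u s → ¬ Above v t′ → ⊥
    no-low-corner sv tu s′v t′u st s′t′ s′≢s t′≢t ¬s ¬t′ with avoiding d sv ¬s t′u ¬t′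
    ... | s″ , t″ , s″v , t″u , s″≢s , t″≢t′ , s″t″ =
      no-matching d sv s′v s″v tu t′u t″u (≢-sym s′≢s) (≢-sym s″≢s)
        (≢-sym (disjointˡ s′v t′u t″u s′t′ s″t″ t″≢t′))
        (≢-sym t′≢t) (≢-sym (disjointʳ sv tu s″v st s″t″ s″≢s)) (≢-sym t″≢t′) st s′t′ s″t″

    -- A negative edge `s′t′` avoiding `s` is disjoint from `st`. If `t′` is low, then `s` and `t′`
    -- form a low corner; if not, `t` and `t′` contradict `above-disjoint` with the sides swapped.
    no-mixed : ∀ {s t} → s ~ v → t ~ u → s ⊖ t → ¬ Above u s → Above v t → ⊥
    no-mixed sv tu st ¬s t↑ with avoiding d sv ¬s (~-sym (u~v d)) (λ (_ , p , ¬p) → ¬p p)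
    ... | s′ , t′ , s′v , t′u , s′≢s , _ , s′t′ with above? v t′
    ...   | no ¬t′ = no-low-corner sv tu s′v t′u st s′t′ s′≢s (disjointʳ sv tu s′v st s′t′ s′≢s) ¬s ¬t′
    ...   | yes t′↑ = above-disjoint (diagonal-sym d) t′u tu s′v sv t′↑ t↑
                        (disjointʳ sv tu s′v st s′t′ s′≢s) s′≢s (⊖-sym s′t′) (⊖-sym st)

  -- A negative edge obstructing `uv` has both ends above or both low. In the low case, a second
  -- edge avoiding both ends must lie above at both ends, since a low end would create a low corner.
  starless⇒middle : ∀ {u v} → Diagonal u v → ¬ ∃ (Star u v) → ¬ ∃ (Star v u) → Middle u v
  starless⇒middle {u} {v} d ¬uv ¬vu
    with avoiding d (u~v d) (λ (_ , p , ¬p) → ¬p p) (~-sym (u~v d)) (λ (_ , p , ¬p) → ¬p p)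
  ... | s , t , sv , tu , _ , _ , st with above? u s | above? v t
  ...   | yes s↑ | yes t↑ = s , t , sv , tu , s↑ , t↑ , st
  ...   | no ¬s  | yes t↑ = ⊥-elim (Starless.no-mixed d ¬uv ¬vu sv tu st ¬s t↑)
  ...   | yes s↑ | no ¬t  = ⊥-elim (Starless.no-mixed (diagonal-sym d) ¬vu ¬uv tu sv (⊖-sym st) ¬t s↑)
  ...   | no ¬s  | no ¬t with avoiding d sv ¬s tu ¬t
  ...     | s′ , t′ , s′v , t′u , s′≢s , t′≢t , s′t′ with above? u s′ | above? v t′
  ...       | yes s′↑ | yes t′↑ = s′ , t′ , s′v , t′u , s′↑ , t′↑ , s′t′
  ...       | _       | no ¬t′  =
    ⊥-elim (Starless.no-low-corner d ¬uv ¬vu sv tu s′v t′u st s′t′ s′≢s t′≢t ¬s ¬t′)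
  ...       | no ¬s′  | _       =
    ⊥-elim (Starless.no-low-corner d ¬uv ¬vu s′v t′u sv tu s′t′ st (≢-sym s′≢s) (≢-sym t′≢t) ¬s′ ¬t)

  -- A star with a high centre is a tilt, and a low star with no star on the other side forces the
  -- opposite tilt; two low stars are impossible.
  trichotomy : ∀ {u v} → Diagonal u v → Tilted u v ⊎ Middle u v ⊎ Tilted v u
  trichotomy {u} {v} d with star? u v | star? v u
  ... | no ¬uv | no ¬vu = inj₂ (inj₁ (starless⇒middle d ¬uv ¬vu))
  ... | yes (x , xs@(xv , q , q′ , qu , q′u , q≢q′ , xq , xq′)) | vu with above? u x | vu
  ...   | yes x↑ | _ = inj₁ (star xv x↑ qu q′u q≢q′ xq xq′)
  ...   | no ¬x  | no ¬vu = inj₂ (inj₂ (low-star⇒tilted d xs ¬x ¬vu))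
  ...   | no ¬x  | yes (y , ys@(yu , p , p′ , pv , p′v , p≢p′ , yp , yp′)) with above? v y
  ...     | yes y↑ = inj₂ (inj₂ (star yu y↑ pv p′v p≢p′ yp yp′))
  ...     | no ¬y  = ⊥-elim (two-low-stars d xs ¬x ys ¬y)
  trichotomy {u} {v} d | no ¬uv | yes (y , ys@(yu , p , p′ , pv , p′v , p≢p′ , yp , yp′)) with above? v y
  ...     | yes y↑ = inj₂ (inj₂ (star yu y↑ pv p′v p≢p′ yp yp′))
  ...     | no ¬y  = inj₁ (low-star⇒tilted (diagonal-sym d) ys ¬y ¬uv)

  -- v′ has the largest neighbourhood among the vertices not adjacent to u, and u′ the smallest
  -- neighbourhood among those adjacent to v′: this is the biclique following N(v) × N(u).
  record Next (u v : V) : Set where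
    field
      {u′ v′}  : V
      diagonal : Diagonal u′ v′
      u≁v′     : ¬ u ~ v′
      above⇒~  : ∀ {x} → x ~ v → Above u x → x ~ v′
      u⊑u′     : u ⊑ u′
      v′⊑v     : v′ ⊑ v
      above⇒~u : ∀ {t} → t ~ u′ → Above v′ t → t ~ u

  next : ∀ {u v x} → Diagonal u v → x ~ v → Above u x → Next u v
  next {u} {v} {x} d x~v (z , x~z , u≁z) = record
    { diagonal = record { u~v = u′~v′ ; biclique = λ x~v′ y~u′ → u′⊑ (∈-allFin _) x~v′ (~-sym y~u′) }
    ; u≁v′     = u≁v′
    ; above⇒~  = λ x~v (z , x~z , u≁z) →
        ~-sym (⊑v′ (∈-allFin _) (same-side (~-sym x~z) (~-sym x~v) , u≁z) (~-sym x~z))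
    ; u⊑u′     = λ u~w → fromInj₂ (⊥-elim ∘ u≁v′) (nested side-u u~w u′~v′)
    ; v′⊑v     = λ v′~y → ~-sym
        (fromInj₂ (⊥-elim ∘ u≁v′) (nested (trans side-u (same-side u′~v′ (~-sym v′~y))) (u~v d) (~-sym v′~y)))
    -- A vertex `t` not adjacent to `u` would have been a candidate for `v′`, so N(t) would lie
    -- inside N(v′).
    ; above⇒~u = λ {t} t~u′ (w , t~w , v′≁w) → ~-sym (decidable-stable (u ~? t) λ u≁t →
        v′≁w (⊑v′ (∈-allFin _) (trans (same-side t~u′ (~-sym u′~v′)) side-v′ , u≁t) t~w))
    }
    where
    P : V → Set
    P y = side G y ≡ side G v × ¬ u ~ y

    -- The order is reverse inclusion, so the minimum has the largest neighbourhood.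
    largest = Minimum.minimum {P = P} (λ y → (side G y ≟ᵇ side G v) ×-dec ¬? (u ~? y))
      {_≼_ = λ a b → b ⊑ a} (λ (p , _) (q , _) → ⊑-total (trans q (≡.sym p))) (λ f g → f ∘ g)
      (allFin (n G)) (same-side (~-sym x~z) (~-sym x~v) , u≁z)

    v′ = proj₁ largest
    side-v′ = proj₁ (proj₁ (proj₂ largest))
    u≁v′ = proj₂ (proj₁ (proj₂ largest))
    z⊑v′ = proj₁ (proj₂ (proj₂ largest))
    ⊑v′ = proj₂ (proj₂ (proj₂ largest))

    smallest = Minimum.minimum {P = _~ v′} (_~? v′) {_≼_ = _⊑_} (λ p q → ⊑-total (same-side p q))
      (λ f g → g ∘ f) (allFin (n G)) (~-sym (z⊑v′ (~-sym x~z)))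

    u′ = proj₁ smallest
    u′~v′ = proj₁ (proj₂ smallest)
    u′⊑ = proj₂ (proj₂ (proj₂ smallest))

    side-u : side G u ≡ side G u′
    side-u = ≢∧≢⇒≡ (~⇒sides (u~v d)) (λ e → ~⇒sides u′~v′ (trans e (≡.sym side-v′)))

  -- Interaction of consecutive bicliques

  module Step {u v} (d : Diagonal u v) (next : Next u v) where
    open Next next

    private
      ~v : ∀ {s} → s ~ v′ → s ~ v
      ~v = ~-sym ∘ v′⊑v ∘ ~-sym

      ~u′ : ∀ {t} → t ~ u → t ~ u′
      ~u′ = ~-sym ∘ u⊑u′ ∘ ~-sym

      above : ∀ {s} → s ~ v′ → Above u s
      above s~v′ = v′ , s~v′ , u≁v′

    -- In the overlap N(v′) × N(u), every vertex of N(v′) is above `u` because of `v′`, so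
    -- `above-disjoint` applies.
    no-disjoint : ∀ {s s′ t t′} → s ~ v′ → s′ ~ v′ → t ~ u → t′ ~ u →
      s ≢ s′ → t ≢ t′ → s ⊖ t → s′ ⊖ t′ → ⊥
    no-disjoint sv′ s′v′ tu t′u = above-disjoint d (~v sv′) (~v s′v′) tu t′u (above sv′) (above s′v′)

    -- Both `xq` and `st` lie in the overlap, so they share an end. If `x` is `s`, the tilt carries
    -- over, as `s` is above `u′`. If only `q` is `t`, a star offers the disjoint edge `xq′`, and a
    -- fork yields negative stars at `q` and `w`.
    middle⇒tilted : Tilted u v → Middle u′ v′ → Tilted u′ v′
    middle⇒tilted (star {x} {q} xv x↑ qu q′u q≢q′ xq xq′) (s , t , sv′ , tu′ , s↑ , t↑ , st)
      with x ≟ s | q ≟ t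
    ... | yes refl | _ = star sv′ s↑ (~u′ qu) (~u′ q′u) q≢q′ xq xq′
    ... | no x≢s | no q≢t =
      ⊥-elim (no-disjoint (above⇒~ xv x↑) sv′ qu (above⇒~u tu′ t↑) x≢s q≢t xq st)
    ... | no x≢s | yes refl =
      ⊥-elim (no-disjoint (above⇒~ xv x↑) sv′ q′u qu x≢s (≢-sym q≢q′) xq′ st)
    middle⇒tilted (fork {x} {q} xv x↑ qu wu q≢w xq x≢b x≢b′ b≢b′ bw b′w bq b′q)
      (s , t , sv′ , tu′ , s↑ , t↑ , st) with x ≟ s | q ≟ t
    ... | yes refl | _ = fork sv′ s↑ (~u′ qu) (~u′ wu) q≢w xq x≢b x≢b′ b≢b′ bw b′w bq b′q
    ... | no x≢s | no q≢t =
      ⊥-elim (no-disjoint (above⇒~ xv x↑) sv′ qu (above⇒~u tu′ t↑) x≢s q≢t xq st)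
    ... | no x≢s | yes refl = ⊥-elim
      (two-negative-stars q≢w x≢s b≢b′ (⊖-sym xq) (⊖-sym st) (⊖-sym bw) (⊖-sym b′w)
        (biclique-sym d xv wu) (biclique-sym d (~v sv′) wu) (~-sym bq) (~-sym b′q))

    -- The edges `xq` and `wp` of the two tilts lie in the overlap and must meet. A meeting at one
    -- end only, or with a star involved, gives disjoint negative edges or two negative stars.
    opposite-tilts : Tilted u v → Tilted v′ u′ → ⊥
    opposite-tilts (star {x} xv x↑ qu q′u q≢q′ xq xq′) (star {w} wu′ w↑ pv′ p′v′ p≢p′ wp wp′)
      with one-differs {P = λ r → x ⊖ r × r ~ u} q≢q′ (xq , qu) (xq′ , q′u) w
         | one-differs {P = λ r → w ⊖ r × r ~ v′} p≢p′ (wp , pv′) (wp′ , p′v′) x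
    ... | r , r≢w , xr , ru | r′ , r′≢x , wr′ , r′v′ =
      no-disjoint (above⇒~ xv x↑) r′v′ ru (above⇒~u wu′ w↑) (≢-sym r′≢x) r≢w xr (⊖-sym wr′)
    opposite-tilts (star {x} {q} {q′} xv x↑ qu q′u q≢q′ xq xq′)
      (fork {w} {p} {z} {r} {r′} wu′ w↑ pv′ zv′ p≢z wp w≢r w≢r′ r≢r′ rz r′z rp r′p) with p ≟ x | q ≟ w
    ... | yes refl | _ = two-negative-stars p≢z q≢q′ r≢r′ xq xq′ (⊖-sym rz) (⊖-sym r′z)
      (biclique d (~v zv′) qu) (biclique d (~v zv′) q′u) (~-sym rp) (~-sym r′p)
    ... | no p≢x | no q≢w =
      no-disjoint (above⇒~ xv x↑) pv′ qu (above⇒~u wu′ w↑) (≢-sym p≢x) q≢w xq (⊖-sym wp)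
    ... | no p≢x | yes refl =
      no-disjoint (above⇒~ xv x↑) pv′ q′u qu (≢-sym p≢x) (≢-sym q≢q′) xq′ (⊖-sym wp)
    opposite-tilts (fork {x} {q} {c} {b} {b′} xv x↑ qu cu q≢c xq x≢b x≢b′ b≢b′ bc b′c bq b′q)
      (star {w} {p} {p′} wu′ w↑ pv′ p′v′ p≢p′ wp wp′) with q ≟ w | p ≟ x
    ... | yes refl | _ = two-negative-stars q≢c p≢p′ b≢b′ wp wp′ (⊖-sym bc) (⊖-sym b′c)
      (biclique-sym d (~v pv′) cu) (biclique-sym d (~v p′v′) cu) (~-sym bq) (~-sym b′q)
    ... | no q≢w | no p≢x =
      no-disjoint (above⇒~ xv x↑) pv′ qu (above⇒~u wu′ w↑) (≢-sym p≢x) q≢w xq (⊖-sym wp)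
    ... | no q≢w | yes refl =
      no-disjoint (above⇒~ xv x↑) p′v′ qu (above⇒~u wu′ w↑) p≢p′ q≢w xq (⊖-sym wp′)
    opposite-tilts (fork {x} {q} {c} {b} {b′} xv x↑ qu cu q≢c xq x≢b x≢b′ b≢b′ bc b′c bq b′q)
      (fork {w} {p} {z} {r} {r′} wu′ w↑ pv′ zv′ p≢z wp w≢r w≢r′ r≢r′ rz r′z rp r′p) with q ≟ w | p ≟ x
    ... | no q≢w | no p≢x =
      no-disjoint (above⇒~ xv x↑) pv′ qu (above⇒~u wu′ w↑) (≢-sym p≢x) q≢w xq (⊖-sym wp)
    ... | no q≢w | yes refl = two-negative-stars p≢z q≢w r≢r′ xq (⊖-sym wp) (⊖-sym rz) (⊖-sym r′z)
      (biclique d (~v zv′) qu) (biclique d (~v zv′) (above⇒~u wu′ w↑)) (~-sym rp) (~-sym r′p)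
    ... | yes refl | no p≢x = two-negative-stars q≢c (≢-sym p≢x) b≢b′ (⊖-sym xq) wp (⊖-sym bc) (⊖-sym b′c)
      (biclique-sym d xv cu) (biclique-sym d (~v pv′) cu) (~-sym bq) (~-sym b′q)
    -- Two forks sharing the edge `xq`, which plays `cq` in F₆. The non-edges of F₆ come from F₅:
    -- with missing pair `v′`, `u` in `u≁`, then with missing pair `u`, `r` in `unrelated`.
    ... | yes refl | yes refl =
      no-F₆ b≢b′ p≢z (≢-sym q≢c) r≢r′
        bc bq (unrelated x≢b bc bq rp (u≁ w≢r rz rp)) (unrelated x≢b bc bq r′p (u≁ w≢r′ r′z r′p))
        b′c b′q (unrelated x≢b′ b′c b′q rp (u≁ w≢r rz rp)) (unrelated x≢b′ b′c b′q r′p (u≁ w≢r′ r′z r′p))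
        (biclique d xv cu) xq (~-sym rp) (~-sym r′p)
        (biclique d (~v zv′) cu) (biclique d (~v zv′) qu) (⊖-sym rz) (⊖-sym r′z)
      where
      u≁ : ∀ {r} → w ≢ r → r ⊖ z → r ~ p → ¬ u ~ r
      u≁ w≢r rz rp ur = no-F₅ w≢r p≢z (~-sym pv′) (~-sym zv′) (u≁v′ ∘ ~-sym)
        wp (biclique-sym d (~v zv′) qu) qu rp rz (~-sym ur)

      unrelated : ∀ {b r} → x ≢ b → b ⊖ c → b ~ q → r ~ p → ¬ u ~ r → ¬ b ~ r
      unrelated x≢b bc bq rp u≁r br = no-F₅ x≢b q≢c (~-sym qu) (~-sym cu) u≁r
        xq (biclique d xv cu) (~-sym rp) bq bc br

  -- Descent along the chain

  tilted⇒next : ∀ {u v} → Diagonal u v → Tilted u v → Next u v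
  tilted⇒next d (star xv x↑ _ _ _ _ _)               = next d xv x↑
  tilted⇒next d (fork xv x↑ _ _ _ _ _ _ _ _ _ _ _) = next d xv x↑

  -- The list `xs` covers N(v). Passing to the next biclique shrinks it strictly: N(v′) lies in N(v)
  -- and loses `u`.
  not-tilted : ∀ {u v} xs → Acc _<_ (length xs) → (∀ {x} → x ~ v → x ∈ xs) → Diagonal u v → ¬ Tilted u v
  not-tilted xs (acc rec) N⊆xs d tilted with tilted⇒next d tilted
  ... | nx with trichotomy (Next.diagonal nx)
  ...   | inj₂ (inj₂ tilted′) = Step.opposite-tilts d nx tilted tilted′
  ...   | inj₁ tilted′ = not-tilted (filter (_~? v′) xs)
    (rec (filter-notAll (_~? v′) xs (lose (N⊆xs (u~v d)) u≁v′)))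
    (λ x~v′ → ∈-filter⁺ (_~? v′) (N⊆xs (~-sym (v′⊑v (~-sym x~v′)))) x~v′) diagonal tilted′
    where open Next nx
  ...   | inj₂ (inj₁ middle) = not-tilted (filter (_~? v′) xs)
    (rec (filter-notAll (_~? v′) xs (lose (N⊆xs (u~v d)) u≁v′)))
    (λ x~v′ → ∈-filter⁺ (_~? v′) (N⊆xs (~-sym (v′⊑v (~-sym x~v′)))) x~v′) diagonal
    (Step.middle⇒tilted d nx tilted middle)
    where open Next nx

  -- A smallest nonempty neighbourhood on the side of `u` gives the first biclique. Nothing in it is
  -- above `v₀`, which leaves only the tilt towards the next biclique.
  no-edge : ∀ {u v} → ¬ u ~ v
  no-edge {u} {v} u~v with Minimum.minimum {P = λ a → side G a ≡ side G u × ∃ (a ~_)}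
    (λ a → (side G a ≟ᵇ side G u) ×-dec any? (a ~?_)) {_≼_ = _⊑_}
    (λ (p , _) (q , _) → ⊑-total (trans p (≡.sym q))) (λ f g → g ∘ f)
    (allFin (n G)) (refl , v , u~v)
  ... | u₀ , (s , v₀ , u₀~v₀) , _ , u₀⊑ = conclude (trichotomy d)
    where
    u₀⊑′ : ∀ {x z} → x ~ z → u₀ ~ z → u₀ ⊑ x
    u₀⊑′ x~z u₀~z = u₀⊑ (∈-allFin _) (trans (same-side x~z u₀~z) s , _ , x~z)

    d : Diagonal u₀ v₀
    d = record { u~v = u₀~v₀ ; biclique = λ x~v₀ y~u₀ → u₀⊑′ x~v₀ u₀~v₀ (~-sym y~u₀) }

    nothing-above : ∀ {t} → t ~ u₀ → ¬ Above v₀ t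
    nothing-above t~u₀ (z , t~z , v₀≁z) = v₀≁z (~-sym (u₀⊑′ (~-sym t~z) (~-sym t~u₀) u₀~v₀))

    conclude : ¬ (Tilted u₀ v₀ ⊎ Middle u₀ v₀ ⊎ Tilted v₀ u₀)
    conclude (inj₁ tilted) = not-tilted (allFin (n G)) (<-wellFounded _) (λ _ → ∈-allFin _) d tilted
    conclude (inj₂ (inj₁ (_ , _ , _ , tu , _ , t↑ , _))) = nothing-above tu t↑
    conclude (inj₂ (inj₂ (star xu x↑ _ _ _ _ _))) = nothing-above xu x↑
    conclude (inj₂ (inj₂ (fork xu x↑ _ _ _ _ _ _ _ _ _ _ _))) = nothing-above xu x↑

-- The two directions of the equivalence

free-after-deletion : ∀ {Fs} G {u v} → All Resilient Fs → Edge (adj G) u v →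
  SignedSimplicial (side G) (adj G) u v →
  All (λ F → ¬ ContainsMemberOf G F) Fs → All (λ F → ¬ ContainsMemberOf (delete G u v) F) Fs
free-after-deletion G []       u~v simp []          = []
free-after-deletion {F ∷ _} G (r ∷ rs) u~v simp (¬F ∷ free) =
  ¬F ∘ contains-before-deletion G {F} r u~v simp ∷ free-after-deletion G rs u~v simp free

chordal⇒free : ∀ {Fs} G → All Resilient Fs → ChordalSignedBigraph G →
  All (λ F → ¬ ContainsMemberOf G F) Fs
chordal⇒free G rs (es , ordering) = All.map
  (λ {F} r (H , H∈F , f , inj , eq) → Copy.no-ordering {F} r H∈F G inj eq es ordering) rs

-- Recursion on the length of a list covering all adjacent ordered pairs; deleting `uv` discards at
-- least the entry `(u , v)`.
free⇒chordal : ∀ G es → Acc _<_ (length es) → (∀ x y → Edge (adj G) x y → (x , y) ∈ es) →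
  NonSeparable G → All (λ F → ¬ ContainsMemberOf G F) forbidden → ChordalSignedBigraph G
free⇒chordal G es (acc rec) E⊆es ns free = search
  (any? λ u → any? λ v → (u ~? v) ×-dec ¬? (obstruction? u v))
  where
  open Graph G

  search : Dec (∃₂ λ u v → u ~ v × ¬ Obstruction u v) → ChordalSignedBigraph G
  -- If every edge is obstructed there is no edge at all, so the empty ordering is complete.
  search (no ¬simplicial) = [] , λ x y → ≁⇒nothing (Obstructed.no-edge G ns free
    λ u~v → decidable-stable (obstruction? _ _) λ ¬o → ¬simplicial (_ , _ , u~v , ¬o))
  search (yes (u , v , u~v , ¬o)) = (u , v) ∷ proj₁ rest , u~v , simp , proj₂ rest
    where
    G′ = delete G u v
    simp = unobstructed⇒simplicial u~v ¬o

    remaining? : (e : V × V) → Dec (Edge (adj G′) (proj₁ e) (proj₂ e))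
    remaining? (x , y) = Graph._~?_ G′ x y

    rest : ChordalSignedBigraph G′
    rest = free⇒chordal G′ (filter remaining? es)
      (rec (filter-notAll remaining? es (lose (E⊆es u v u~v) λ e → e (deleteEdge-nothing (adj G) u v))))
      (λ x y e → ∈-filter⁺ remaining? (E⊆es x y (deleteEdge-mono (adj G) u v e)) e)
      (Deletion.delete-nonSeparable G u~v simp ns)
      (free-after-deletion G forbidden-resilient u~v simp free)

theorem3p2 : (G : SignedBigraph) → NonSeparable G →
    ChordalSignedBigraph G ⇔ All (λ F → ¬ ContainsMemberOf G F) forbidden
theorem3p2 G ns = mk⇔ (chordal⇒free G forbidden-resilient)
  (free⇒chordal G (cartesianProduct (allFin (n G)) (allFin (n G))) (<-wellFounded _)
    (λ x y _ → ∈-cartesianProduct⁺ (∈-allFin x) (∈-allFin y)) ns)
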